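{- Up to $\mathrm{S5}$-equivalence there are exactly four $\mathrm{S5}$-additive formulas without parameters (i.e. formulas in $\mathrm{Fm}(p)$): $\bot$, $p$, $\Diamond p$, and $\top$. Exactly three of them are normal in $\mathrm{S5}$: $\bot$, $p$, and $\Diamond p$.
   Context: $\mathrm{Fm}(p)$ is the set of modal formulas (built with Boolean connectives, $\bot,\top,\Diamond,\Box$) containing no variables other than $p$. For a normal modal logic $\Lambda$, formulas $\varphi,\psi$ are $\Lambda$-equivalent if $\Lambda\vdash\varphi\leftrightarrow\psi$. A formula $\varphi(p)$ is $\Lambda$-additive if $\Lambda\vdash\varphi(p\vee q)\leftrightarrow\varphi(p)\vee\varphi(q)$ (with $q$ a variable distinct from $p$), and normal in $\Lambda$ if $\Lambda\vdash\varphi(\bot)\leftrightarrow\bot$. $\mathrm{S5}$ is the usual normal modal logic of frames whose relation is an equivalence relation. -}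

module Defs where

open import Data.Empty using (⊥)
open import Data.List using (List)
open import Data.List.Relation.Unary.All using (All)
open import Data.List.Relation.Unary.AllPairs using (AllPairs)
open import Data.List.Relation.Unary.Any using (Any)
open import Data.Nat using (ℕ; zero; suc)
open import Data.Product using (Σ; _×_)
open import Data.Sum using (_⊎_)
open import Data.Unit using (⊤)
open import Level using (Level; 0ℓ; _⊔_) renaming (suc to lsuc)
open import Relation.Binary using (Rel; IsEquivalence)
open import Relation.Binary.PropositionalEquality using (_≡_)
open import Relation.Nullary using (¬_; Dec)
open import Relation.Unary using (Pred; _∈_)

Var : Set
Var = ℕ

infix  9 ¬′_ ◇_ □_
infixr 8 _∧′_
infixr 7 _∨′_
infixr 6 _⇒′_
infix  5 _⇔′_

data Formula : Set where
  var            : Var → Formula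
  ⊥′ ⊤′          : Formula
  ¬′_ ◇_ □_      : Formula → Formula
  _∧′_ _∨′_ _⇒′_ : Formula → Formula → Formula

_⇔′_ : Formula → Formula → Formula
φ ⇔′ ψ = (φ ⇒′ ψ) ∧′ (ψ ⇒′ φ)

p q : Formula
p = var 0
q = var 1

Fm⟨p⟩ : Pred Formula 0ℓ
Fm⟨p⟩ (var x)  = x ≡ 0
Fm⟨p⟩ ⊥′       = ⊤
Fm⟨p⟩ ⊤′       = ⊤
Fm⟨p⟩ (¬′ φ)   = Fm⟨p⟩ φ
Fm⟨p⟩ (◇ φ)    = Fm⟨p⟩ φ
Fm⟨p⟩ (□ φ)    = Fm⟨p⟩ φ
Fm⟨p⟩ (φ ∧′ ψ) = Fm⟨p⟩ φ × Fm⟨p⟩ ψ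
Fm⟨p⟩ (φ ∨′ ψ) = Fm⟨p⟩ φ × Fm⟨p⟩ ψ
Fm⟨p⟩ (φ ⇒′ ψ) = Fm⟨p⟩ φ × Fm⟨p⟩ ψ

-- φ ⟨ χ ⟩ is φ(χ), the result of substituting χ for p in φ = φ(p).
infix 10 _⟨_⟩
_⟨_⟩ : Formula → Formula → Formula
var zero    ⟨ χ ⟩ = χ
var (suc x) ⟨ χ ⟩ = var (suc x)
⊥′          ⟨ χ ⟩ = ⊥′
⊤′          ⟨ χ ⟩ = ⊤′
(¬′ φ)      ⟨ χ ⟩ = ¬′ (φ ⟨ χ ⟩)
(◇ φ)       ⟨ χ ⟩ = ◇ (φ ⟨ χ ⟩)
(□ φ)       ⟨ χ ⟩ = □ (φ ⟨ χ ⟩)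
(φ ∧′ ψ)    ⟨ χ ⟩ = φ ⟨ χ ⟩ ∧′ ψ ⟨ χ ⟩
(φ ∨′ ψ)    ⟨ χ ⟩ = φ ⟨ χ ⟩ ∨′ ψ ⟨ χ ⟩
(φ ⇒′ ψ)    ⟨ χ ⟩ = φ ⟨ χ ⟩ ⇒′ ψ ⟨ χ ⟩

-- A logic is identified with its set of theorems.
Logic : Set₂
Logic = Pred Formula (lsuc 0ℓ)

infix 4 _⊢_
_⊢_ : Logic → Formula → Set₁
Λ ⊢ φ = φ ∈ Λ

Equivalent : Logic → Formula → Formula → Set₁
Equivalent Λ φ ψ = Λ ⊢ φ ⇔′ ψ

-- Meant for φ ∈ Fm⟨p⟩, so that q does not occur in φ.
Additive : Logic → Formula → Set₁
Additive Λ φ = Λ ⊢ φ ⟨ p ∨′ q ⟩ ⇔′ φ ⟨ p ⟩ ∨′ φ ⟨ q ⟩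

Normal : Logic → Formula → Set₁
Normal Λ φ = Λ ⊢ φ ⟨ ⊥′ ⟩ ⇔′ ⊥′

record Frame : Set₁ where
  field
    World : Set
    R     : Rel World 0ℓ

  Valuation : Set₁
  Valuation = Var → Pred World 0ℓ

  infix 4 _,_⊩_
  _,_⊩_ : Valuation → World → Formula → Set
  V , w ⊩ var x  = w ∈ V x
  V , w ⊩ ⊥′     = ⊥
  V , w ⊩ ⊤′     = ⊤
  V , w ⊩ ¬′ φ   = ¬ (V , w ⊩ φ)
  V , w ⊩ ◇ φ    = Σ World λ v → R w v × (V , v ⊩ φ)
  V , w ⊩ □ φ    = ∀ v → R w v → V , v ⊩ φ
  V , w ⊩ φ ∧′ ψ = (V , w ⊩ φ) × (V , w ⊩ ψ)
  V , w ⊩ φ ∨′ ψ = (V , w ⊩ φ) ⊎ (V , w ⊩ ψ)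
  V , w ⊩ φ ⇒′ ψ = V , w ⊩ φ → V , w ⊩ ψ

  -- Truth is two-valued: each formula is true or false at each world.
  -- By excluded middle every valuation has this property; constructively it
  -- has to be asked for, since otherwise φ ∨ ¬ φ would not be valid.
  TwoValued : Valuation → Set
  TwoValued V = ∀ φ w → Dec (V , w ⊩ φ)

  Valid : Formula → Set₁
  Valid φ = ∀ V → TwoValued V → ∀ w → V , w ⊩ φ

LogicOf : Pred Frame 0ℓ → Logic
LogicOf 𝓕 φ = ∀ F → F ∈ 𝓕 → Frame.Valid F φ

S5 : Logic
S5 = LogicOf (λ F → IsEquivalence (Frame.R F))

-- Up to Λ-equivalence, the formulas satisfying P are exactly the members of
-- the list, and these are pairwise inequivalent; so their number is its length.
ExactlyUpToEquivalence : {ℓ : Level} → Logic → Pred Formula ℓ → List Formula → Set (lsuc 0ℓ ⊔ ℓ)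
ExactlyUpToEquivalence Λ P φs =
    All P φs
  × AllPairs (λ φ ψ → ¬ Equivalent Λ φ ψ) φs
  × (∀ φ → φ ∈ P → Any (Equivalent Λ φ) φs)

{-# OPTIONS --safe #-}
-- Relative to a set X, a point of an S5 cluster has one of four positions: X is
-- the whole cluster, X is empty there, or X is neither and the point lies inside
-- or outside X.  A formula in Fm⟨p⟩ is determined up to S5-equivalence by its
-- truth values in these four positions relative to the extension of p, since
-- "having the same position" is a bisimulation.  Additivity forces f t ≡ f empty ∨ f t,
-- f full ≡ f inside ∨ f outside (a point and its complement) and
-- f inside ≡ f inside ∨ f outside (two points out of three) on the truth values f,
-- which leaves only those of ⊥, p, ◇ p and ⊤.
module Submission where

open import Data.Bool using (Bool; true; false; not; _∧_; _∨_; T)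
open import Data.Bool.Properties using (T?)
open import Data.Fin using (Fin; zero)
open import Data.Fin.Properties using (any?; all?)
open import Data.List using (_∷_; [])
open import Data.List.Relation.Unary.All using (_∷_; [])
open import Data.List.Relation.Unary.AllPairs using (_∷_; [])
open import Data.List.Relation.Unary.Any using (Any; here; there)
open import Data.Nat using (zero; suc)
open import Data.Product using (Σ; _×_; _,_; proj₁; proj₂)
open import Data.Sum using (_⊎_; inj₁; inj₂)
open import Data.Unit using (⊤; tt)
open import Data.Vec using (Vec; _∷_; []; lookup)
open import Function using (id)
open import Function.Bundles using (mk⇔)
open import Relation.Binary using (IsEquivalence)
open import Relation.Binary.PropositionalEquality using (_≡_; _≢_; refl; sym; trans; cong; cong₂; subst)
open import Relation.Nullary using (¬_; yes; no; contradiction; Reflects; _because_; proof; ofʸ; ofⁿ; of;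
  ¬-reflects; _×-reflects_; _⊎-reflects_; _→-reflects_)
open import Relation.Nullary.Decidable using (True; toWitness; map′; decidable-stable; does-⇔;
  ¬?; _×-dec_; _⊎-dec_; _→-dec_)
open import Defs

data Position : Set where
  full inside outside empty : Position

-- The set is given by an arbitrary formula rather than by `p`, because additivity compares the
-- positions of one point relative to `p ∨′ q`, `p` and `q`.
atPosition : Position → Formula → Formula
atPosition full    ψ = □ ψ
atPosition inside  ψ = ψ ∧′ ◇ ¬′ ψ
atPosition outside ψ = ¬′ ψ ∧′ ◇ ψ
atPosition empty   ψ = □ ¬′ ψ

-- The positions occurring in the cluster of a point at position t are t and mate t.
mate : Position → Position
mate full    = full
mate inside  = outside
mate outside = inside
mate empty   = empty

-- Every variable is read as p, so this is meaningful only on Fm⟨p⟩.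
eval : Formula → Position → Bool
eval (var x)  full    = true
eval (var x)  inside  = true
eval (var x)  outside = false
eval (var x)  empty   = false
eval ⊥′       t = false
eval ⊤′       t = true
eval (¬′ φ)   t = not (eval φ t)
eval (◇ φ)    t = eval φ t ∨ eval φ (mate t)
eval (□ φ)    t = eval φ t ∧ eval φ (mate t)
eval (φ ∧′ ψ) t = eval φ t ∧ eval ψ t
eval (φ ∨′ ψ) t = eval φ t ∨ eval ψ t
eval (φ ⇒′ ψ) t = not (eval φ t) ∨ eval ψ t

Reflects-transfer : {A B : Set} {b : Bool} → Reflects A b → Reflects B b → A → B
Reflects-transfer (ofʸ _)  (ofʸ b) _ = b
Reflects-transfer (ofⁿ ¬a) _       a = contradiction a ¬a

-- Sharing a position is a bisimulation

module _ (F : Frame) (R-equiv : IsEquivalence (Frame.R F)) where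
  open Frame F
  private module R = IsEquivalence R-equiv

  module _ (V : Valuation) (V-dec : TwoValued V) (ψ : Formula) where

    position : ∀ w → Σ Position λ t → V , w ⊩ atPosition t ψ
    position w with V-dec ψ w | V-dec (◇ ¬′ ψ) w | V-dec (◇ ψ) w
    ... | yes w∈ | yes ◇¬ | _      = inside , w∈ , ◇¬
    ... | yes w∈ | no ¬◇¬ | _      = full , λ v Rwv → decidable-stable (V-dec ψ v) λ v∉ → ¬◇¬ (v , Rwv , v∉)
    ... | no w∉  | _      | yes ◇ψ = outside , w∉ , ◇ψ
    ... | no w∉  | _      | no ¬◇ψ = empty , λ v Rwv v∈ → ¬◇ψ (v , Rwv , v∈)

    -- For `full` and `empty` transitivity suffices. In the other two cases, if `v` is on the side
    -- of `w`, the witness `u` stays visible from `v` by symmetry and transitivity; otherwise `w`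
    -- itself is the witness for `v`.
    forth : ∀ t {w v} → R w v → V , w ⊩ atPosition t ψ →
            (V , v ⊩ atPosition t ψ) ⊎ (V , v ⊩ atPosition (mate t) ψ)
    forth full  Rwv all  = inj₁ λ u Rvu → all u (R.trans Rwv Rvu)
    forth empty Rwv none = inj₁ λ u Rvu → none u (R.trans Rwv Rvu)
    forth inside {w} {v} Rwv (w∈ , u , Rwu , u∉) with V-dec ψ v
    ... | yes v∈ = inj₁ (v∈ , u , R.trans (R.sym Rwv) Rwu , u∉)
    ... | no v∉  = inj₂ (v∉ , w , R.sym Rwv , w∈)
    forth outside {w} {v} Rwv (w∉ , u , Rwu , u∈) with V-dec ψ v
    ... | yes v∈ = inj₂ (v∈ , w , R.sym Rwv , w∉)
    ... | no v∉  = inj₁ (v∉ , u , R.trans (R.sym Rwv) Rwu , u∈)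

    back : ∀ t {w} → V , w ⊩ atPosition t ψ → Σ World λ v → R w v × (V , v ⊩ atPosition (mate t) ψ)
    back full    {w} all                   = w , R.refl , all
    back inside  {w} (w∈ , u , Rwu , u∉)   = u , Rwu , u∉ , w , R.sym Rwu , w∈
    back outside {w} (w∉ , u , Rwu , u∈)   = u , Rwu , u∈ , w , R.sym Rwu , w∉
    back empty   {w} none                  = w , R.refl , none

    -- Induction on `φ` for all positions and worlds at once, since the modal cases use the
    -- hypothesis at `mate t` and at other worlds. `Reflects` carries truth and falsity together, as
    -- negation requires.
    eval-reflects : ∀ φ → Fm⟨p⟩ φ → ∀ t {w} → V , w ⊩ atPosition t ψ → Reflects (V , w ⊩ φ ⟨ ψ ⟩) (eval φ t)
    eval-reflects (var zero) _ full    all      = of (all _ R.refl)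
    eval-reflects (var zero) _ inside  (w∈ , _) = of w∈
    eval-reflects (var zero) _ outside (w∉ , _) = of w∉
    eval-reflects (var zero) _ empty   none     = of (none _ R.refl)
    eval-reflects ⊥′       _ t at = of id
    eval-reflects ⊤′       _ t at = of tt
    eval-reflects (¬′ φ)   φ∈ t at = ¬-reflects (eval-reflects φ φ∈ t at)
    eval-reflects (φ ∧′ χ) (φ∈ , χ∈) t at = eval-reflects φ φ∈ t at ×-reflects eval-reflects χ χ∈ t at
    eval-reflects (φ ∨′ χ) (φ∈ , χ∈) t at = eval-reflects φ φ∈ t at ⊎-reflects eval-reflects χ χ∈ t at
    eval-reflects (φ ⇒′ χ) (φ∈ , χ∈) t at = eval-reflects φ φ∈ t at →-reflects eval-reflects χ χ∈ t at
    eval-reflects (◇ φ) φ∈ t {w} at with back t at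
    -- The worlds `w` and `u` represent the positions of the cluster: `forth` places every successor
    -- at `t` or `mate t`, where `φ ⟨ ψ ⟩` has the same truth value as at the representative.
    ... | u , Rwu , at′ = proof (map′ to from (_ because (here-reflects ⊎-reflects mate-reflects)))
      where
      here-reflects = eval-reflects φ φ∈ t at
      mate-reflects = eval-reflects φ φ∈ (mate t) at′
      to : (V , w ⊩ φ ⟨ ψ ⟩) ⊎ (V , u ⊩ φ ⟨ ψ ⟩) → V , w ⊩ ◇ φ ⟨ ψ ⟩
      to (inj₁ h) = w , R.refl , h
      to (inj₂ h) = u , Rwu , h
      from : V , w ⊩ ◇ φ ⟨ ψ ⟩ → (V , w ⊩ φ ⟨ ψ ⟩) ⊎ (V , u ⊩ φ ⟨ ψ ⟩)
      from (v , Rwv , h) with forth t Rwv at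
      ... | inj₁ at″ = inj₁ (Reflects-transfer (eval-reflects φ φ∈ t at″) here-reflects h)
      ... | inj₂ at″ = inj₂ (Reflects-transfer (eval-reflects φ φ∈ (mate t) at″) mate-reflects h)
    eval-reflects (□ φ) φ∈ t {w} at with back t at
    ... | u , Rwu , at′ = proof (map′ to from (_ because (here-reflects ×-reflects mate-reflects)))
      where
      here-reflects = eval-reflects φ φ∈ t at
      mate-reflects = eval-reflects φ φ∈ (mate t) at′
      to : (V , w ⊩ φ ⟨ ψ ⟩) × (V , u ⊩ φ ⟨ ψ ⟩) → V , w ⊩ □ φ ⟨ ψ ⟩
      to (hw , hu) v Rwv with forth t Rwv at
      ... | inj₁ at″ = Reflects-transfer here-reflects (eval-reflects φ φ∈ t at″) hw
      ... | inj₂ at″ = Reflects-transfer mate-reflects (eval-reflects φ φ∈ (mate t) at″) hu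
      from : V , w ⊩ □ φ ⟨ ψ ⟩ → (V , w ⊩ φ ⟨ ψ ⟩) × (V , u ⊩ φ ⟨ ψ ⟩)
      from h = h w R.refl , h u Rwu

⟨p⟩-identity : ∀ φ → φ ⟨ p ⟩ ≡ φ
⟨p⟩-identity (var zero)    = refl
⟨p⟩-identity (var (suc x)) = refl
⟨p⟩-identity ⊥′       = refl
⟨p⟩-identity ⊤′       = refl
⟨p⟩-identity (¬′ φ)   = cong ¬′_ (⟨p⟩-identity φ)
⟨p⟩-identity (◇ φ)    = cong ◇_ (⟨p⟩-identity φ)
⟨p⟩-identity (□ φ)    = cong □_ (⟨p⟩-identity φ)
⟨p⟩-identity (φ ∧′ ψ) = cong₂ _∧′_ (⟨p⟩-identity φ) (⟨p⟩-identity ψ)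
⟨p⟩-identity (φ ∨′ ψ) = cong₂ _∨′_ (⟨p⟩-identity φ) (⟨p⟩-identity ψ)
⟨p⟩-identity (φ ⇒′ ψ) = cong₂ _⇒′_ (⟨p⟩-identity φ) (⟨p⟩-identity ψ)

-- Every world has some position relative to `p`, and this position fixes the truth value of both
-- formulas.
eval-≗⇒Equivalent : ∀ φ ψ → Fm⟨p⟩ φ → Fm⟨p⟩ ψ → (∀ t → eval φ t ≡ eval ψ t) → Equivalent S5 φ ψ
eval-≗⇒Equivalent φ ψ φ∈ ψ∈ φ≗ψ F R-equiv V V-dec w with position F R-equiv V V-dec p w
... | t , at = Reflects-transfer φ-reflects ψ-reflects , Reflects-transfer ψ-reflects φ-reflects
  where
  open Frame F
  reflects : ∀ χ → Fm⟨p⟩ χ → Reflects (V , w ⊩ χ) (eval χ t)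
  reflects χ χ∈ = subst (λ χ′ → Reflects (V , w ⊩ χ′) (eval χ t)) (⟨p⟩-identity χ)
                    (eval-reflects F R-equiv V V-dec p χ χ∈ t at)
  φ-reflects = subst (Reflects _) (φ≗ψ t) (reflects φ φ∈)
  ψ-reflects = reflects ψ ψ∈

-- Truth values read off a three-point cluster

-- Three points are the least that admit two disjoint nonempty sets whose union is not the whole
-- cluster, as `inside-max` requires.
triangle : Frame
triangle = record { World = Fin 3 ; R = λ _ _ → ⊤ }

triangle-equiv : IsEquivalence (Frame.R triangle)
triangle-equiv = record { refl = tt ; sym = id ; trans = λ _ _ → tt }

module _ (P Q : Vec Bool 3) where
  open Frame triangle

  valuation : Valuation
  valuation zero    w = T (lookup P w)
  valuation (suc _) w = T (lookup Q w)

  twoValued : TwoValued valuation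
  twoValued (var zero)    w = T? (lookup P w)
  twoValued (var (suc _)) w = T? (lookup Q w)
  twoValued ⊥′       w = no id
  twoValued ⊤′       w = yes tt
  twoValued (¬′ φ)   w = ¬? (twoValued φ w)
  twoValued (◇ φ)    w = any? λ v → yes tt ×-dec twoValued φ v
  twoValued (□ φ)    w = all? λ v → yes tt →-dec twoValued φ v
  twoValued (φ ∧′ ψ) w = twoValued φ w ×-dec twoValued ψ w
  twoValued (φ ∨′ ψ) w = twoValued φ w ⊎-dec twoValued ψ w
  twoValued (φ ⇒′ ψ) w = twoValued φ w →-dec twoValued ψ w

  -- For concrete vectors the decision computes and `True` reduces to the unit type, so implicit
  -- arguments of this type are solved automatically.
  OriginAt : Position → Formula → Set
  OriginAt t ψ = True (twoValued (atPosition t ψ) zero)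

  origin-reflects : ∀ φ → Fm⟨p⟩ φ → ∀ t ψ {_ : OriginAt t ψ} → Reflects (valuation , zero ⊩ φ ⟨ ψ ⟩) (eval φ t)
  origin-reflects φ φ∈ t ψ {at} =
    eval-reflects triangle triangle-equiv valuation twoValued ψ φ φ∈ t (toWitness at)

  Equivalent⇒≡ : ∀ φ ψ {a b} → Equivalent S5 φ ψ →
                 Reflects (valuation , zero ⊩ φ) a → Reflects (valuation , zero ⊩ ψ) b → a ≡ b
  Equivalent⇒≡ _ _ φ⇔ψ ra rb = does-⇔ (mk⇔ to from) (_ because ra) (_ because rb)
    where
    both = φ⇔ψ triangle triangle-equiv valuation twoValued zero
    to   = proj₁ both
    from = proj₂ both

  -- Additivity is read at the single point `zero`, so each choice of extensions for `p` and `q`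
  -- yields one Boolean equation between entries of the truth table.
  Additive⇒eval : ∀ φ → Fm⟨p⟩ φ → Additive S5 φ → ∀ r s t
                  {_ : OriginAt r (p ∨′ q)} {_ : OriginAt s p} {_ : OriginAt t q} →
                  eval φ r ≡ eval φ s ∨ eval φ t
  Additive⇒eval φ φ∈ add r s t {r-at} {s-at} {t-at} =
    Equivalent⇒≡ (φ ⟨ p ∨′ q ⟩) (φ ⟨ p ⟩ ∨′ φ ⟨ q ⟩) add
      (origin-reflects φ φ∈ r (p ∨′ q) {r-at})
      (origin-reflects φ φ∈ s p {s-at} ⊎-reflects origin-reflects φ φ∈ t q {t-at})

-- Each position is realised at the origin by a suitable extension of `p`.
Equivalent⇒eval-≗ : ∀ φ ψ → Fm⟨p⟩ φ → Fm⟨p⟩ ψ → Equivalent S5 φ ψ → ∀ t → eval φ t ≡ eval ψ t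
Equivalent⇒eval-≗ φ ψ φ∈ ψ∈ φ⇔ψ = λ where
    full    → at (true  ∷ true  ∷ true  ∷ []) full
    inside  → at (true  ∷ false ∷ false ∷ []) inside
    outside → at (false ∷ true  ∷ false ∷ []) outside
    empty   → at (false ∷ false ∷ false ∷ []) empty
  where
  φ⇔ψ⟨p⟩ : Equivalent S5 (φ ⟨ p ⟩) (ψ ⟨ p ⟩)
  φ⇔ψ⟨p⟩ = subst (S5 ⊢_) (sym (cong₂ _⇔′_ (⟨p⟩-identity φ) (⟨p⟩-identity ψ))) φ⇔ψ
  at : ∀ P t {_ : OriginAt P P t p} → eval φ t ≡ eval ψ t
  at P t {o} = Equivalent⇒≡ P P (φ ⟨ p ⟩) (ψ ⟨ p ⟩) φ⇔ψ⟨p⟩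
    (origin-reflects P P φ φ∈ t p {o}) (origin-reflects P P ψ ψ∈ t p {o})

-- Relative to `⊥′` every point is at `empty`.
Normal⇒eval-empty : ∀ φ → Fm⟨p⟩ φ → Normal S5 φ → eval φ empty ≡ false
Normal⇒eval-empty φ φ∈ normal =
  Equivalent⇒≡ none none (φ ⟨ ⊥′ ⟩) ⊥′ normal (origin-reflects none none φ φ∈ empty ⊥′) (ofⁿ id)
  where none = false ∷ false ∷ false ∷ []

-- Truth values of additive formulas

record AdditiveValues (f : Position → Bool) : Set where
  field
    above-empty : ∀ t → f t ≡ f empty ∨ f t
    full-split  : f full ≡ f inside ∨ f outside
    inside-max  : f inside ≡ f inside ∨ f outside

Additive⇒AdditiveValues : ∀ φ → Fm⟨p⟩ φ → Additive S5 φ → AdditiveValues (eval φ)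
Additive⇒AdditiveValues φ φ∈ add = record
  { above-empty = λ where
      -- With `p` empty, `p ∨′ q` has the extension of `q`, which is chosen to put the origin at the
      -- desired position.
      full    → Additive⇒eval none all  φ φ∈ add full    empty full
      inside  → Additive⇒eval none w₀   φ φ∈ add inside  empty inside
      outside → Additive⇒eval none w₁   φ φ∈ add outside empty outside
      empty   → Additive⇒eval none none φ φ∈ add empty   empty empty
  ; full-split  = Additive⇒eval w₀ w₁₂ φ φ∈ add full   inside outside
  -- The union of `w₀` and `w₁` misses the third point, so the origin stays `inside`.
  ; inside-max  = Additive⇒eval w₀ w₁  φ φ∈ add inside inside outside
  }
  where
  none = false ∷ false ∷ false ∷ []
  all  = true  ∷ true  ∷ true  ∷ []
  w₀   = true  ∷ false ∷ false ∷ []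
  w₁   = false ∷ true  ∷ false ∷ []
  w₁₂  = false ∷ true  ∷ true  ∷ []

-- `full-split` determines `f full`, so it suffices to split on the other three values.
AdditiveValues-classified : ∀ {f} → AdditiveValues f →
  Any (λ ψ → ∀ t → f t ≡ eval ψ t) (⊥′ ∷ p ∷ ◇ p ∷ ⊤′ ∷ [])
AdditiveValues-classified {f} f-add = classify (f outside) (f inside) (f empty) refl refl refl
  where
  open AdditiveValues f-add
  classify : ∀ o i e → f outside ≡ o → f inside ≡ i → f empty ≡ e →
    Any (λ ψ → ∀ t → f t ≡ eval ψ t) (⊥′ ∷ p ∷ ◇ p ∷ ⊤′ ∷ [])
  -- By `above-empty`, truth at `empty` propagates to every position.
  classify o i true _ _ fe = there (there (there (here λ t → trans (above-empty t) (cong (_∨ f t) fe))))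
  classify false false false fo fi fe = here λ where
    full    → trans full-split (cong₂ _∨_ fi fo)
    inside  → fi
    outside → fo
    empty   → fe
  classify false true false fo fi fe = there (here λ where
    full    → trans full-split (cong₂ _∨_ fi fo)
    inside  → fi
    outside → fo
    empty   → fe)
  -- By `inside-max`, truth at `outside` would force truth at `inside`.
  classify true false false fo fi fe = contradiction (trans (trans (sym fi) inside-max) (cong₂ _∨_ fi fo)) λ ()
  classify true true false fo fi fe = there (there (here λ where
    full    → trans full-split (cong₂ _∨_ fi fo)
    inside  → fi
    outside → fo
    empty   → fe))

-- The four formulas and their inequivalence

⊥-additive : Additive S5 ⊥′
⊥-additive F _ V _ w = (λ ()) , λ { (inj₁ ()) ; (inj₂ ()) }

p-additive : Additive S5 p
p-additive F _ V _ w = id , id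

◇p-additive : Additive S5 (◇ p)
◇p-additive F _ V _ w =
  (λ { (v , Rwv , inj₁ h) → inj₁ (v , Rwv , h) ; (v , Rwv , inj₂ h) → inj₂ (v , Rwv , h) }) ,
  (λ { (inj₁ (v , Rwv , h)) → v , Rwv , inj₁ h ; (inj₂ (v , Rwv , h)) → v , Rwv , inj₂ h })

⊤-additive : Additive S5 ⊤′
⊤-additive F _ V _ w = inj₁ , λ _ → tt

⊥-normal : Normal S5 ⊥′
⊥-normal F _ V _ w = id , id

p-normal : Normal S5 p
p-normal F _ V _ w = id , id

◇p-normal : Normal S5 (◇ p)
◇p-normal F _ V _ w = (λ { (_ , _ , ()) }) , λ ()

inequivalent : ∀ φ ψ → Fm⟨p⟩ φ → Fm⟨p⟩ ψ → ∀ t → eval φ t ≢ eval ψ t → ¬ Equivalent S5 φ ψ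
inequivalent φ ψ φ∈ ψ∈ t φ≢ψ φ⇔ψ = φ≢ψ (Equivalent⇒eval-≗ φ ψ φ∈ ψ∈ φ⇔ψ t)

⊥≢p : ¬ Equivalent S5 ⊥′ p
⊥≢p = inequivalent ⊥′ p tt refl full λ ()

⊥≢◇p : ¬ Equivalent S5 ⊥′ (◇ p)
⊥≢◇p = inequivalent ⊥′ (◇ p) tt refl full λ ()

⊥≢⊤ : ¬ Equivalent S5 ⊥′ ⊤′
⊥≢⊤ = inequivalent ⊥′ ⊤′ tt tt full λ ()

p≢◇p : ¬ Equivalent S5 p (◇ p)
-- `outside` is the only position that separates these two.
p≢◇p = inequivalent p (◇ p) refl refl outside λ ()

p≢⊤ : ¬ Equivalent S5 p ⊤′
p≢⊤ = inequivalent p ⊤′ refl tt empty λ ()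

◇p≢⊤ : ¬ Equivalent S5 (◇ p) ⊤′
◇p≢⊤ = inequivalent (◇ p) ⊤′ refl tt empty λ ()

corollary4p6 : ExactlyUpToEquivalence S5 (λ φ → Fm⟨p⟩ φ × Additive S5 φ) (⊥′ ∷ p ∷ ◇ p ∷ ⊤′ ∷ [])
    × ExactlyUpToEquivalence S5 (λ φ → Fm⟨p⟩ φ × Additive S5 φ × Normal S5 φ) (⊥′ ∷ p ∷ ◇ p ∷ [])
corollary4p6 =
  ( (tt , ⊥-additive) ∷ (refl , p-additive) ∷ (refl , ◇p-additive) ∷ (tt , ⊤-additive) ∷ []
  , (⊥≢p ∷ ⊥≢◇p ∷ ⊥≢⊤ ∷ []) ∷ (p≢◇p ∷ p≢⊤ ∷ []) ∷ (◇p≢⊤ ∷ []) ∷ [] ∷ []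
  , additive-complete ) ,
  ( (tt , ⊥-additive , ⊥-normal) ∷ (refl , p-additive , p-normal) ∷ (refl , ◇p-additive , ◇p-normal) ∷ []
  , (⊥≢p ∷ ⊥≢◇p ∷ []) ∷ (p≢◇p ∷ []) ∷ [] ∷ []
  , normal-complete )
  where
  additive-complete : ∀ φ → Fm⟨p⟩ φ × Additive S5 φ → Any (Equivalent S5 φ) (⊥′ ∷ p ∷ ◇ p ∷ ⊤′ ∷ [])
  additive-complete φ (φ∈ , add) with AdditiveValues-classified (Additive⇒AdditiveValues φ φ∈ add)
  ... | here e                         = here (eval-≗⇒Equivalent φ ⊥′ φ∈ tt e)
  ... | there (here e)                 = there (here (eval-≗⇒Equivalent φ p φ∈ refl e))
  ... | there (there (here e))         = there (there (here (eval-≗⇒Equivalent φ (◇ p) φ∈ refl e)))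
  ... | there (there (there (here e))) = there (there (there (here (eval-≗⇒Equivalent φ ⊤′ φ∈ tt e))))

  normal-complete : ∀ φ → Fm⟨p⟩ φ × Additive S5 φ × Normal S5 φ → Any (Equivalent S5 φ) (⊥′ ∷ p ∷ ◇ p ∷ [])
  normal-complete φ (φ∈ , add , normal) with additive-complete φ (φ∈ , add)
  ... | here e                         = here e
  ... | there (here e)                 = there (here e)
  ... | there (there (here e))         = there (there (here e))
  ... | there (there (there (here e))) =
    -- Of the four candidates only `⊤′` is true at `empty`, where normality demands falsity.
    contradiction (trans (sym (Normal⇒eval-empty φ φ∈ normal)) (Equivalent⇒eval-≗ φ ⊤′ φ∈ tt e empty)) λ ()
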